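{- Let $H$ be a 3-uniform hypergraph. Then $H$ is realizable if and only if for every $W\subseteq V(H)$ such that $H[W]$ is prime, $H[W]$ is realizable.
   Context: All structures are finite. A 3-uniform hypergraph $H$ consists of a vertex set $V(H)$ and an edge set $E(H)\subseteq\binom{V(H)}{3}$. For $W\subseteq V(H)$, $H[W]$ is the hypergraph with vertex set $W$ and edge set $\{e\in E(H):e\subseteq W\}$. A 3-cycle is a tournament on three vertices isomorphic to $(\{0,1,2\},\{01,12,20\})$. The $C_3$-structure $C_3(T)$ of a tournament $T$ is the 3-uniform hypergraph on $V(T)$ whose edges are the 3-element subsets $X$ of $V(T)$ such that $T[X]$ is a 3-cycle. A tournament $T$ with $V(T)=V(H)$ is a realization of $H$ if $H=C_3(T)$; $H$ is realizable if it admits a realization. A subset $M$ of $V(H)$ is a module of $H$ if for each $e\in E(H)$ such that $e\cap M\neq\emptyset$ and $e\setminus M\neq\emptyset$, there exists $m\in M$ such that $e\cap M=\{m\}$ and for every $n\in M$, $(e\setminus\{m\})\cup\{n\}\in E(H)$. The sets $\emptyset$, $V(H)$ and $\{v\}$ ($v\in V(H)$) are modules, called trivial. $H$ is prime if $|V(H)|\geq 3$ and all its modules are trivial. -}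

module Defs where

open import Level using (0ℓ)
open import Data.Empty using (⊥-elim)
open import Data.Nat using (ℕ; _≤_)
import Data.Nat.Properties as ℕ
open import Data.Fin using (Fin)
open import Data.Fin.Patterns using (0F; 1F; 2F)
open import Data.Fin.Properties using (_≟_; any?; all?)
open import Data.Fin.Subset
open import Data.Fin.Subset.Properties using (∈⊤; _∈?_; _⊆?_)
open import Data.Product using (Σ-syntax; ∃-syntax; _×_; _,_; proj₁; proj₂)
open import Data.Sum using (_⊎_; inj₁; inj₂; [_,_]′)
open import Data.Vec using (lookup; []; _∷_)
open import Data.Vec.Properties.WithK using ([]=-irrelevant)
open import Function.Bundles using (_↔_; _⇔_; mk⇔; mk↔ₛ′; module Inverse; module Equivalence)
open import Relation.Binary.Core using (Rel)
open import Relation.Binary.Definitions using (Asymmetric) renaming (Decidable to Decidable₂)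
open import Relation.Binary.PropositionalEquality
  using (_≡_; _≢_; refl; sym; trans; cong; subst₂)
open import Relation.Nullary using (¬_; Dec; yes; no)
open import Relation.Nullary.Decidable using (map′; _×-dec_; _→-dec_)
open import Relation.Unary using (Pred; Decidable)

-- Vertex sets are subsets of an ambient Fin n, so that H [ W ] has vertex set
-- W itself.

record Tournament (n : ℕ) : Set₁ where
  infix 4 _⟶_
  field
    V     : Subset n
    _⟶_   : Rel (Fin n) 0ℓ
    ⟶⇒∈V  : ∀ {x y} → x ⟶ y → x ∈ V × y ∈ V
    asym  : Asymmetric _⟶_
    total : ∀ {x y} → x ∈ V → y ∈ V → x ≢ y → x ⟶ y ⊎ y ⟶ x

  irrefl : ∀ {x y} → x ≡ y → ¬ (x ⟶ y)
  irrefl refl x⟶x = asym x⟶x x⟶x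

  _⟶?_ : Decidable₂ _⟶_
  x ⟶? y with x ∈? V | y ∈? V | x ≟ y
  ... | no x∉V  | _       | _       = no λ x⟶y → x∉V (proj₁ (⟶⇒∈V x⟶y))
  ... | yes _   | no y∉V  | _       = no λ x⟶y → y∉V (proj₂ (⟶⇒∈V x⟶y))
  ... | yes _   | yes _   | yes x≡y = no (irrefl x≡y)
  ... | yes x∈V | yes y∈V | no x≢y  = [ yes , (λ y⟶x → no (asym y⟶x)) ]′ (total x∈V y∈V x≢y)

  Vertex : Set
  Vertex = ∃[ x ] x ∈ V

  vertex-≡ : {u v : Vertex} → proj₁ u ≡ proj₁ v → u ≡ v
  vertex-≡ {x , p} {_ , q} refl = cong (x ,_) ([]=-irrelevant p q)

subtournament : ∀ {n} (T : Tournament n) (X : Subset n) → X ⊆ Tournament.V T → Tournament n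
subtournament T X X⊆V = record
  { V     = X
  ; _⟶_   = λ x y → (x ∈ X × y ∈ X) × x ⟶ y
  ; ⟶⇒∈V  = proj₁
  ; asym  = λ p q → asym (proj₂ p) (proj₂ q)
  ; total = λ x∈X y∈X x≢y →
      [ (λ a → inj₁ ((x∈X , y∈X) , a)) , (λ a → inj₂ ((y∈X , x∈X) , a)) ]′
        (total (X⊆V x∈X) (X⊆V y∈X) x≢y)
  }
  where open Tournament T

infix 4 _≅_

_≅_ : ∀ {m n} → Tournament m → Tournament n → Set
S ≅ T = Σ[ f ∈ S.Vertex ↔ T.Vertex ]
  (∀ u v → (proj₁ u S.⟶ proj₁ v) ⇔ (proj₁ (Inverse.to f u) T.⟶ proj₁ (Inverse.to f v)))
  where
  module S = Tournament S
  module T = Tournament T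

data _⟶₃_ : Rel (Fin 3) 0ℓ where
  0⟶1 : 0F ⟶₃ 1F
  1⟶2 : 1F ⟶₃ 2F
  2⟶0 : 2F ⟶₃ 0F

⟶₃-total : ∀ i j → i ≢ j → i ⟶₃ j ⊎ j ⟶₃ i
⟶₃-total 0F 0F i≢j = ⊥-elim (i≢j refl)
⟶₃-total 0F 1F _   = inj₁ 0⟶1
⟶₃-total 0F 2F _   = inj₂ 2⟶0
⟶₃-total 1F 0F _   = inj₂ 0⟶1
⟶₃-total 1F 1F i≢j = ⊥-elim (i≢j refl)
⟶₃-total 1F 2F _   = inj₁ 1⟶2
⟶₃-total 2F 0F _   = inj₁ 2⟶0
⟶₃-total 2F 1F _   = inj₂ 1⟶2
⟶₃-total 2F 2F i≢j = ⊥-elim (i≢j refl)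

cycle₃ : Tournament 3
cycle₃ = record
  { V     = ⊤
  ; _⟶_   = _⟶₃_
  ; ⟶⇒∈V  = λ _ → ∈⊤ , ∈⊤
  ; asym  = λ { 0⟶1 () ; 1⟶2 () ; 2⟶0 () }
  ; total = λ {i} {j} _ _ → ⟶₃-total i j
  }

Is3Cycle : ∀ {n} → Tournament n → Set
Is3Cycle T = T ≅ cycle₃

-- An equivalent form of Is3Cycle that can be decided by search; it serves
-- only to show that the edge set of C₃ T is decidable.

module _ {n : ℕ} (T : Tournament n) where
  open Tournament T renaming (V to VT)

  triple : Fin n → Fin n → Fin n → Fin 3 → Fin n
  triple a b c = lookup (a ∷ b ∷ c ∷ [])

  Cyclic : Fin n → Fin n → Fin n → Set
  Cyclic a b c = ((a ⟶ b) × (b ⟶ c) × (c ⟶ a))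
               × (∀ x → x ∈ VT → ∃[ i ] x ≡ triple a b c i)

  cyclic? : ∀ a b c → Dec (Cyclic a b c)
  cyclic? a b c = ((a ⟶? b) ×-dec (b ⟶? c) ×-dec (c ⟶? a))
    ×-dec all? (λ x → (x ∈? VT) →-dec any? (λ i → x ≟ triple a b c i))

  to-Is3Cycle : (∃[ a ] ∃[ b ] ∃[ c ] Cyclic a b c) → Is3Cycle T
  to-Is3Cycle (a , b , c , (ab , bc , ca) , cover) =
    mk↔ₛ′ to from to∘from from∘to , λ u v → mk⇔ (arc⇒ u v) (arc⇐ u v)
    where
    g : Fin 3 → Fin n
    g = triple a b c

    g-arc : ∀ {i j} → i ⟶₃ j → g i ⟶ g j
    g-arc 0⟶1 = ab
    g-arc 1⟶2 = bc
    g-arc 2⟶0 = ca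

    g-inj : ∀ {i j} → g i ≡ g j → i ≡ j
    g-inj {i} {j} eq with i ≟ j
    ... | yes i≡j = i≡j
    ... | no i≢j = ⊥-elim ([ (λ p → irrefl eq (g-arc p))
                          , (λ p → irrefl (sym eq) (g-arc p)) ]′ (⟶₃-total i j i≢j))

    g-arc⁻¹ : ∀ {i j} → g i ⟶ g j → i ⟶₃ j
    g-arc⁻¹ {i} {j} p with i ≟ j
    ... | yes i≡j = ⊥-elim (irrefl (cong g i≡j) p)
    ... | no i≢j = [ (λ q → q) , (λ q → ⊥-elim (asym p (g-arc q))) ]′ (⟶₃-total i j i≢j)

    g∈ : ∀ i → g i ∈ VT
    g∈ 0F = proj₁ (⟶⇒∈V ab)
    g∈ 1F = proj₁ (⟶⇒∈V bc)
    g∈ 2F = proj₁ (⟶⇒∈V ca)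

    to : Vertex → Tournament.Vertex cycle₃
    to (x , x∈) = proj₁ (cover x x∈) , ∈⊤

    from : Tournament.Vertex cycle₃ → Vertex
    from (i , _) = g i , g∈ i

    to-g : ∀ u → proj₁ u ≡ g (proj₁ (to u))
    to-g (x , x∈) = proj₂ (cover x x∈)

    to∘from : ∀ v → to (from v) ≡ v
    to∘from v = Tournament.vertex-≡ cycle₃ (g-inj (sym (to-g (from v))))

    from∘to : ∀ u → from (to u) ≡ u
    from∘to u = vertex-≡ (sym (to-g u))

    arc⇒ : ∀ u v → proj₁ u ⟶ proj₁ v → proj₁ (to u) ⟶₃ proj₁ (to v)
    arc⇒ u v p = g-arc⁻¹ (subst₂ _⟶_ (to-g u) (to-g v) p)

    arc⇐ : ∀ u v → proj₁ (to u) ⟶₃ proj₁ (to v) → proj₁ u ⟶ proj₁ v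
    arc⇐ u v p = subst₂ _⟶_ (sym (to-g u)) (sym (to-g v)) (g-arc p)

  from-Is3Cycle : Is3Cycle T → ∃[ a ] ∃[ b ] ∃[ c ] Cyclic a b c
  from-Is3Cycle (f , arcs) =
    g 0F , g 1F , g 2F , (arc 0⟶1 , arc 1⟶2 , arc 2⟶0) , cover
    where
    module f = Inverse f

    g : Fin 3 → Fin n
    g i = proj₁ (f.from (i , ∈⊤))

    to-from : ∀ i → proj₁ (f.to (f.from (i , ∈⊤))) ≡ i
    to-from i = cong proj₁ (f.strictlyInverseˡ (i , ∈⊤))

    arc : ∀ {i j} → i ⟶₃ j → g i ⟶ g j
    arc {i} {j} p = Equivalence.from (arcs _ _)
      (subst₂ _⟶₃_ (sym (to-from i)) (sym (to-from j)) p)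

    g-triple : ∀ i → g i ≡ triple (g 0F) (g 1F) (g 2F) i
    g-triple 0F = refl
    g-triple 1F = refl
    g-triple 2F = refl

    cover : ∀ x → x ∈ VT → ∃[ i ] x ≡ triple (g 0F) (g 1F) (g 2F) i
    cover x x∈ = i , trans (cong proj₁ x≡) (g-triple i)
      where
      i = proj₁ (f.to (x , x∈))
      x≡ : (x , x∈) ≡ f.from (i , ∈⊤)
      x≡ = trans (sym (f.strictlyInverseʳ (x , x∈)))
                 (cong f.from (Tournament.vertex-≡ cycle₃ refl))

  is3Cycle? : Dec (Is3Cycle T)
  is3Cycle? = map′ to-Is3Cycle from-Is3Cycle
    (any? λ a → any? λ b → any? λ c → cyclic? a b c)

-- The field E? says, constructively, that the edges form a finite set (of
-- subsets of Fin n).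

record Hypergraph (n : ℕ) : Set₁ where
  field
    V      : Subset n
    E      : Pred (Subset n) 0ℓ
    E?     : Decidable E
    E⇒⊆V   : ∀ {e} → E e → e ⊆ V
    E⇒∣∣≡3 : ∀ {e} → E e → ∣ e ∣ ≡ 3

open Hypergraph using (V; E)

infix 4 _≈_

_≈_ : ∀ {n} → Hypergraph n → Hypergraph n → Set
G ≈ H = V G ≡ V H × (∀ e → E G e ⇔ E H e)

-- Meant for W ⊆ V H; the definition itself does not need the inclusion.

infix 8 _[_]

_[_] : ∀ {n} → Hypergraph n → Subset n → Hypergraph n
H [ W ] = record
  { V      = W
  ; E      = λ e → E H e × e ⊆ W
  ; E?     = λ e → Hypergraph.E? H e ×-dec (e ⊆? W)
  ; E⇒⊆V   = proj₂
  ; E⇒∣∣≡3 = λ e∈ → Hypergraph.E⇒∣∣≡3 H (proj₁ e∈)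
  }

C₃ : ∀ {n} → Tournament n → Hypergraph n
C₃ {n} T = record
  { V      = Tournament.V T
  ; E      = Edge
  ; E?     = edge?
  ; E⇒⊆V   = proj₁
  ; E⇒∣∣≡3 = λ e → proj₁ (proj₂ e)
  }
  where
  Edge : Pred (Subset n) 0ℓ
  Edge X = Σ[ X⊆V ∈ X ⊆ Tournament.V T ] (∣ X ∣ ≡ 3 × Is3Cycle (subtournament T X X⊆V))

  edge? : Decidable Edge
  edge? X with X ⊆? Tournament.V T
  ... | no X⊈V = no λ e → X⊈V (proj₁ e)
  ... | yes X⊆V = map′ (X⊆V ,_) proj₂
    ((∣ X ∣ ℕ.≟ 3) ×-dec is3Cycle? (subtournament T X X⊆V))

-- H ≈ C₃ T includes V H ≡ V T.

_Realizes_ : ∀ {n} → Tournament n → Hypergraph n → Set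
T Realizes H = H ≈ C₃ T

Realizable : ∀ {n} → Hypergraph n → Set₁
Realizable H = ∃[ T ] T Realizes H

record Module {n} (H : Hypergraph n) (M : Subset n) : Set where
  field
    M⊆V     : M ⊆ V H
    replace : ∀ e → E H e → Nonempty (e ∩ M) → Nonempty (e ─ M) →
              ∃[ m ] m ∈ M × e ∩ M ≡ ⁅ m ⁆ × (∀ k → k ∈ M → E H ((e - m) ∪ ⁅ k ⁆))

Trivial : ∀ {n} → Hypergraph n → Subset n → Set
Trivial H M = M ≡ ⊥ ⊎ M ≡ V H ⊎ (∃[ v ] v ∈ V H × M ≡ ⁅ v ⁆)

Prime : ∀ {n} → Hypergraph n → Set
Prime H = 3 ≤ ∣ V H ∣ × (∀ M → Module H M → Trivial H M)

{-# OPTIONS --safe #-}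
-- A nontrivial module M of H splits the problem in two: realizations of H[M]
-- and of H with M contracted to one of its vertices m glue to a realization of
-- H, since an edge meeting M in one vertex may have that vertex replaced by m,
-- and no edge meets M in exactly two vertices. A hypergraph with no nontrivial
-- module is prime, or has at most two vertices and hence no edges.
module Submission where

open import Defs
open import Data.Empty using (⊥-elim)
open import Data.Nat using (ℕ; suc; _≤_; _<_; _≤?_)
open import Data.Nat.Induction using (<-wellFounded)
open import Data.Nat.Properties using (≤-trans; ≤-reflexive; suc-injective)
open import Data.Fin using (Fin; zero; suc)
import Data.Fin as Fin
import Data.Fin.Properties as Fin
open import Data.Fin.Properties using (_≟_; all?; any?)
open import Data.Fin.Subset
open import Data.Fin.Subset.Properties
open import Data.Product using (∃-syntax; _×_; _,_; proj₁; proj₂)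
open import Data.Product.Function.NonDependent.Propositional using (_×-⇔_)
open import Data.Sum using (_⊎_; inj₁; inj₂; [_,_]′)
import Data.Sum as Sum
open import Data.Sum.Function.Propositional using (_⊎-⇔_)
open import Data.Vec using ([]; _∷_; here; there)
open import Data.Vec.Properties using (≡-dec)
import Data.Bool.Properties as Bool
open import Function.Base using (id; _∘_)
open import Function.Bundles using (_⇔_; mk⇔; module Equivalence)
open import Function.Construct.Composition using (_⇔-∘_)
open import Function.Construct.Identity using (⇔-id)
open import Function.Construct.Symmetry using (⇔-sym)
open import Induction.WellFounded using (Acc; acc)
open import Relation.Binary.Definitions using (DecidableEquality; tri<; tri≈; tri>)
open import Relation.Binary.PropositionalEquality
  using (_≡_; _≢_; refl; sym; trans; cong; subst; subst₂; ≢-sym)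
open import Relation.Nullary using (¬_; Dec; yes; no)
open import Relation.Nullary.Decidable
  using (map′; _×-dec_; _⊎-dec_; _→-dec_; ¬?; decidable-stable; toWitness)
open import Relation.Unary using (Decidable)

open Hypergraph using (V; E; E?; E⇒⊆V; E⇒∣∣≡3)
open Equivalence using (to; from)

private variable
  n : ℕ
  a b c k m x y : Fin n
  p q M W : Subset n
  H : Hypergraph n
  T : Tournament n

-- Finite subsets

infix 4 _≟ˢ_

_≟ˢ_ : DecidableEquality (Subset n)
_≟ˢ_ = ≡-dec Bool._≟_

-- Being a module is a condition on all subsets `e`; it is decided by searching for a
-- counterexample.
allSubset? : {P : Subset n → Set} → Decidable P → Dec (∀ p → P p)
allSubset? P? = map′ (λ ¬∃ p → decidable-stable (P? p) (λ ¬Pp → ¬∃ (p , ¬Pp)))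
                     (λ ∀P (p , ¬Pp) → ¬Pp (∀P p))
                     (¬? (anySubset? (¬? ∘ P?)))

x∈p─q⇒x∉q : (p q : Subset n) → x ∈ p ─ q → x ∉ q
x∈p─q⇒x∉q (_ ∷ _) (outside ∷ _) here        ()
x∈p─q⇒x∉q (_ ∷ p) (_ ∷ q)       (there x∈) (there x∈q) = x∈p─q⇒x∉q p q x∈ x∈q

x∈p-y⇒x≢y : (p : Subset n) → x ∈ p - y → x ≢ y
x∈p-y⇒x≢y p x∈ = x∉⁅y⁆⇒x≢y (x∈p─q⇒x∉q p _ x∈)

⊆∧≢⇒⊂ : p ⊆ q → p ≢ q → p ⊂ q
⊆∧≢⇒⊂ {p = p} {q = q} p⊆q p≢q with p ⊂? q
... | yes p⊂q = p⊂q
... | no  p⊄q = ⊥-elim (p≢q (⊆-antisym p⊆q λ {x} x∈q →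
  decidable-stable (x ∈? p) λ x∉p → p⊄q (p⊆q , x , x∈q , x∉p)))

∣⁅x⁆∪p∣ : (p : Subset n) → x ∉ p → ∣ ⁅ x ⁆ ∪ p ∣ ≡ suc ∣ p ∣
∣⁅x⁆∪p∣ {x = zero}  (inside  ∷ p) x∉p = ⊥-elim (x∉p here)
∣⁅x⁆∪p∣ {x = zero}  (outside ∷ p) _   = cong (suc ∘ ∣_∣) (∪-identityˡ p)
∣⁅x⁆∪p∣ {x = suc x} (inside  ∷ p) x∉p = cong suc (∣⁅x⁆∪p∣ p (x∉p ∘ there))
∣⁅x⁆∪p∣ {x = suc x} (outside ∷ p) x∉p = ∣⁅x⁆∪p∣ p (x∉p ∘ there)

⁅x⁆∪[p-x]≡p : x ∈ p → ⁅ x ⁆ ∪ (p - x) ≡ p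
⁅x⁆∪[p-x]≡p {x = x} {p = p} x∈p = ⊆-antisym
  (λ y∈ → [ (λ y∈⁅x⁆ → subst (_∈ p) (sym (x∈⁅y⁆⇒x≡y x y∈⁅x⁆)) x∈p) , p─q⊆p p ⁅ x ⁆ ]′
            (x∈p∪q⁻ ⁅ x ⁆ (p - x) y∈))
  ⊆∪
  where
  ⊆∪ : p ⊆ ⁅ x ⁆ ∪ (p - x)
  ⊆∪ {y} y∈p with y ≟ x
  ... | yes refl = x∈p∪q⁺ (inj₁ (x∈⁅x⁆ x))
  ... | no  y≢x  = x∈p∪q⁺ (inj₂ (x∈p∧x≢y⇒x∈p-y y∈p y≢x))

∣p∣≡suc⇒∪ : ∀ (p : Subset n) {l} → ∣ p ∣ ≡ suc l →
            ∃[ x ] x ∈ p × p ≡ ⁅ x ⁆ ∪ (p - x) × ∣ p - x ∣ ≡ l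
∣p∣≡suc⇒∪ {n} p ∣p∣≡ with nonempty? p
... | yes (x , x∈p) = x , x∈p , sym p≡ , suc-injective
  (trans (sym (∣⁅x⁆∪p∣ (p - x) λ x∈ → x∈p-y⇒x≢y p x∈ refl)) (trans (cong ∣_∣ p≡) ∣p∣≡))
  where p≡ = ⁅x⁆∪[p-x]≡p x∈p
... | no empty with trans (sym ∣p∣≡) (trans (cong ∣_∣ (Empty-unique empty)) (∣⊥∣≡0 n))
...   | ()

∣p∣≡0⇒p≡⊥ : (p : Subset n) → ∣ p ∣ ≡ 0 → p ≡ ⊥
∣p∣≡0⇒p≡⊥ []            _    = refl
∣p∣≡0⇒p≡⊥ (outside ∷ p) ∣p∣≡ = cong (outside ∷_) (∣p∣≡0⇒p≡⊥ p ∣p∣≡)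

-- Triples

tri : Fin n → Fin n → Fin n → Subset n
tri a b c = ⁅ a ⁆ ∪ (⁅ b ⁆ ∪ ⁅ c ⁆)

-- The inequalities run cyclically, like the arcs of `Cyc`, so rotating a triple only permutes them.
Distinct : Fin n → Fin n → Fin n → Set
Distinct a b c = a ≢ b × b ≢ c × c ≢ a

∈tri⁻ : x ∈ tri a b c → x ≡ a ⊎ x ≡ b ⊎ x ≡ c
∈tri⁻ {a = a} {b = b} {c = c} x∈ =
  Sum.map (x∈⁅y⁆⇒x≡y a) (Sum.map (x∈⁅y⁆⇒x≡y b) (x∈⁅y⁆⇒x≡y c) ∘ x∈p∪q⁻ ⁅ b ⁆ ⁅ c ⁆)
    (x∈p∪q⁻ ⁅ a ⁆ (⁅ b ⁆ ∪ ⁅ c ⁆) x∈)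

∈tri⁺ : x ≡ a ⊎ x ≡ b ⊎ x ≡ c → x ∈ tri a b c
∈tri⁺ (inj₁ refl)        = x∈p∪q⁺ (inj₁ (x∈⁅x⁆ _))
∈tri⁺ (inj₂ (inj₁ refl)) = x∈p∪q⁺ (inj₂ (x∈p∪q⁺ (inj₁ (x∈⁅x⁆ _))))
∈tri⁺ (inj₂ (inj₂ refl)) = x∈p∪q⁺ (inj₂ (x∈p∪q⁺ (inj₂ (x∈⁅x⁆ _))))

module _ (a b c : Fin n) where
  a∈tri : a ∈ tri a b c
  a∈tri = ∈tri⁺ (inj₁ refl)

  b∈tri : b ∈ tri a b c
  b∈tri = ∈tri⁺ (inj₂ (inj₁ refl))

  c∈tri : c ∈ tri a b c
  c∈tri = ∈tri⁺ (inj₂ (inj₂ refl))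

  tri-rotate : tri a b c ≡ tri b c a
  tri-rotate = trans (∪-comm ⁅ a ⁆ _) (∪-assoc ⁅ b ⁆ ⁅ c ⁆ ⁅ a ⁆)

tri⊆ : a ∈ p → b ∈ p → c ∈ p → tri a b c ⊆ p
tri⊆ a∈ b∈ c∈ x∈ with ∈tri⁻ x∈
... | inj₁ refl        = a∈
... | inj₂ (inj₁ refl) = b∈
... | inj₂ (inj₂ refl) = c∈

∣tri∣≡3 : Distinct a b c → ∣ tri a b c ∣ ≡ 3
∣tri∣≡3 {a = a} {b = b} {c = c} (a≢b , b≢c , c≢a) =
  trans (∣⁅x⁆∪p∣ _ λ a∈ → [ a≢b ∘ x∈⁅y⁆⇒x≡y b , ≢-sym c≢a ∘ x∈⁅y⁆⇒x≡y c ]′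
                            (x∈p∪q⁻ ⁅ b ⁆ ⁅ c ⁆ a∈))
    (cong suc (trans (∣⁅x⁆∪p∣ _ (x≢y⇒x∉⁅y⁆ b≢c)) (cong suc (∣⁅x⁆∣≡1 c))))

-- Vertices are peeled off one at a time; distinctness is read off from membership in the successive
-- differences.
∣p∣≡3⇒tri : (p : Subset n) → ∣ p ∣ ≡ 3 → ∃[ a ] ∃[ b ] ∃[ c ] Distinct a b c × p ≡ tri a b c
∣p∣≡3⇒tri p ∣p∣≡3 with ∣p∣≡suc⇒∪ p ∣p∣≡3
... | a , _ , p≡ , ∣q∣≡2 with ∣p∣≡suc⇒∪ (p - a) ∣q∣≡2
... | b , b∈ , q≡ , ∣r∣≡1 with ∣p∣≡suc⇒∪ (p - a - b) ∣r∣≡1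
... | c , c∈ , r≡ , ∣s∣≡0 =
  a , b , c ,
  ( ≢-sym (x∈p-y⇒x≢y p b∈)
  , ≢-sym (x∈p-y⇒x≢y (p - a) c∈)
  , x∈p-y⇒x≢y p (p─q⊆p (p - a) ⁅ b ⁆ c∈)) ,
  trans p≡ (cong (⁅ a ⁆ ∪_) (trans q≡ (cong (⁅ b ⁆ ∪_) (trans r≡
    (trans (cong (⁅ c ⁆ ∪_) (∣p∣≡0⇒p≡⊥ _ ∣s∣≡0)) (∪-identityʳ ⁅ c ⁆))))))

-- Realizations in terms of triples

module _ (T : Tournament n) where
  open Tournament T using (_⟶_)

  Cyc : Fin n → Fin n → Fin n → Set
  Cyc a b c = a ⟶ b × b ⟶ c × c ⟶ a

  -- `tri a b c` is unordered, so an edge on it can be a 3-cycle in either of two orientations.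
  Cyc± : Fin n → Fin n → Fin n → Set
  Cyc± a b c = Cyc a b c ⊎ Cyc a c b

Cyc⇒Distinct : Cyc T a b c → Distinct a b c
Cyc⇒Distinct {T = T} (ab , bc , ca) =
  (λ e → irrefl e ab) , (λ e → irrefl e bc) , (λ e → irrefl e ca)
  where open Tournament T

Cyc±-rotate : Cyc± T a b c → Cyc± T b c a
Cyc±-rotate = Sum.map (λ (ab , bc , ca) → bc , ca , ab) (λ (ac , cb , ba) → ba , ac , cb)

Cyc⇒edge : Cyc T a b c → E (C₃ T) (tri a b c)
Cyc⇒edge {T = T} {a = a} {b = b} {c = c} cyc@(ab , bc , ca) =
  ⊆V , ∣tri∣≡3 (Cyc⇒Distinct {T = T} cyc) ,
  to-Is3Cycle (subtournament T (tri a b c) ⊆V) (a , b , c ,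
    (((a∈ , b∈) , ab) , ((b∈ , c∈) , bc) , ((c∈ , a∈) , ca)) ,
    λ _ x∈ → index (∈tri⁻ x∈))
  where
  open Tournament T
  ⊆V : tri a b c ⊆ Tournament.V T
  ⊆V = tri⊆ (proj₁ (⟶⇒∈V ab)) (proj₁ (⟶⇒∈V bc)) (proj₁ (⟶⇒∈V ca))
  a∈ = a∈tri a b c
  b∈ = b∈tri a b c
  c∈ = c∈tri a b c
  index : x ≡ a ⊎ x ≡ b ⊎ x ≡ c → ∃[ i ] x ≡ triple T a b c i
  index (inj₁ e)        = zero , e
  index (inj₂ (inj₁ e)) = suc zero , e
  index (inj₂ (inj₂ e)) = suc (suc zero) , e

-- Settled by running a decision procedure on all triples of `Fin 3`.
Cyc±-cycle₃ : ∀ i j k → Distinct i j k → Cyc± cycle₃ i j k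
Cyc±-cycle₃ = toWitness {a? = all? λ i → all? λ j → all? λ k →
  ((¬? (i ≟ j)) ×-dec (¬? (j ≟ k)) ×-dec (¬? (k ≟ i)))
    →-dec (((i ⟶? j) ×-dec (j ⟶? k) ×-dec (k ⟶? i))
      ⊎-dec ((i ⟶? k) ×-dec (k ⟶? j) ×-dec (j ⟶? i)))} _
  where open Tournament cycle₃

edge⇒Cyc± : Distinct a b c → E (C₃ T) (tri a b c) → Cyc± T a b c
edge⇒Cyc± {a = a} {b = b} {c = c} {T = T} (a≢b , b≢c , c≢a) (⊆V , _ , is3)
  with from-Is3Cycle (subtournament T (tri a b c) ⊆V) is3
... | p , q , r , ((_ , pq) , (_ , qr) , (_ , rp)) , cover
  with cover a (a∈tri a b c) | cover b (b∈tri a b c) | cover c (c∈tri a b c)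
-- `from-Is3Cycle` lists the vertices in an order of its own; `i`, `j`, `k` are the positions of
-- `a`, `b`, `c` in that list, and cycles of positions transfer along `g`.
... | i , refl | j , refl | k , refl =
  Sum.map lift lift (Cyc±-cycle₃ i j k
    (a≢b ∘ cong g , b≢c ∘ cong g , c≢a ∘ cong g))
  where
  open Tournament T
  g = triple T p q r
  arc : ∀ {i j} → i ⟶₃ j → g i ⟶ g j
  arc 0⟶1 = pq
  arc 1⟶2 = qr
  arc 2⟶0 = rp
  lift : ∀ {i j k} → Cyc cycle₃ i j k → Cyc T (g i) (g j) (g k)
  lift (ij , jk , ki) = arc ij , arc jk , arc ki

C₃-edge⇔ : Distinct a b c → E (C₃ T) (tri a b c) ⇔ Cyc± T a b c
C₃-edge⇔ {a = a} {b = b} {c = c} {T = T} abc = mk⇔ (edge⇒Cyc± {T = T} abc)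
  [ Cyc⇒edge {T = T}
  -- The opposite orientation gives an edge on `tri a c b`, which is the same set.
  , (λ acb → subst (E (C₃ T)) (cong (⁅ a ⁆ ∪_) (∪-comm ⁅ c ⁆ ⁅ b ⁆)) (Cyc⇒edge {T = T} acb)) ]′

-- Replaces the isomorphisms hidden in `C₃` by arcs. Nothing is lost, since every edge on either
-- side has three elements and so is some `tri a b c`.
RealizesTriples : Tournament n → Hypergraph n → Set
RealizesTriples T H = V H ≡ Tournament.V T ×
  (∀ a b c → Distinct a b c → E H (tri a b c) ⇔ Cyc± T a b c)

Realizes⇒RealizesTriples : T Realizes H → RealizesTriples T H
Realizes⇒RealizesTriples {T = T} (V≡ , E⇔) =
  V≡ , λ a b c abc → C₃-edge⇔ {T = T} abc ⇔-∘ E⇔ (tri a b c)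

RealizesTriples⇒Realizes : RealizesTriples T H → T Realizes H
RealizesTriples⇒Realizes {T = T} {H = H} (V≡ , E⇔) =
  V≡ , λ e → mk⇔ (λ Ee → to   (at e (E⇒∣∣≡3 H Ee)) Ee)
                 (λ Ee → from (at e (E⇒∣∣≡3 (C₃ T) Ee)) Ee)
  where
  at : ∀ e → ∣ e ∣ ≡ 3 → E H e ⇔ E (C₃ T) e
  at e ∣e∣≡3 with ∣p∣≡3⇒tri e ∣e∣≡3
  ... | a , b , c , abc , refl = ⇔-sym (C₃-edge⇔ {T = T} abc) ⇔-∘ E⇔ a b c abc

-- Realizability of induced subhypergraphs

≈-realizable : (G H : Hypergraph n) → G ≈ H → Realizable H → Realizable G
≈-realizable _ _ (V≡ , E⇔) (T , V≡′ , E⇔′) = T , trans V≡ V≡′ , λ e → E⇔′ e ⇔-∘ E⇔ e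

[]-realizable : W ⊆ V H → Realizable H → Realizable (H [ W ])
[]-realizable {W = W} {H = H} W⊆V (T , T-H@(V≡ , _)) =
  T′ , RealizesTriples⇒Realizes {T = T′} {H = H [ W ]} (refl , λ a b c abc → mk⇔
    (λ (Ee , e⊆W) →
      let a∈ = e⊆W (a∈tri a b c); b∈ = e⊆W (b∈tri a b c); c∈ = e⊆W (c∈tri a b c) in
      Sum.map (λ (ab , bc , ca) → ((a∈ , b∈) , ab) , ((b∈ , c∈) , bc) , ((c∈ , a∈) , ca))
              (λ (ac , cb , ba) → ((a∈ , c∈) , ac) , ((c∈ , b∈) , cb) , ((b∈ , a∈) , ba))
              (to (E⇔ a b c abc) Ee))
    (λ cyc → from (E⇔ a b c abc)
               (Sum.map (λ (ab , bc , ca) → proj₂ ab , proj₂ bc , proj₂ ca)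
                        (λ (ac , cb , ba) → proj₂ ac , proj₂ cb , proj₂ ba) cyc)
           -- The first arc and the tail of the third place all three vertices in `W`.
           , [ (λ (((a∈ , b∈) , _) , _ , ((c∈ , _) , _)) → tri⊆ a∈ b∈ c∈)
             , (λ (((a∈ , c∈) , _) , _ , ((b∈ , _) , _)) → tri⊆ a∈ b∈ c∈) ]′ cyc))
  where
  T′ : Tournament _
  T′ = subtournament T W (λ x∈ → subst (_ ∈_) V≡ (W⊆V x∈))
  E⇔ : ∀ a b c → Distinct a b c → E H (tri a b c) ⇔ Cyc± T a b c
  E⇔ = proj₂ (Realizes⇒RealizesTriples {T = T} {H = H} T-H)

[]-edge : ∀ (H : Hypergraph n) {e} → E H e → e ⊆ W → E (H [ W ]) e
[]-edge _ Ee e⊆W = Ee , e⊆W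

-- The induction splits `H [ W ]`, whereas its hypothesis concerns induced subhypergraphs of `H`
-- itself.
[]-[] : M ⊆ W → (H [ W ]) [ M ] ≈ H [ M ]
[]-[] {M = M} {W = W} {H = H} M⊆W = refl , λ e →
  mk⇔ {A = E ((H [ W ]) [ M ]) e} {B = E (H [ M ]) e}
    (λ ((Ee , _) , e⊆M) → Ee , e⊆M)
    (λ (Ee , e⊆M) → (Ee , λ x∈ → M⊆W (e⊆M x∈)) , e⊆M)

[V]-≈ : (H : Hypergraph n) → H ≈ H [ V H ]
[V]-≈ H = refl , λ e → mk⇔ (λ Ee → []-edge H Ee (E⇒⊆V H Ee)) proj₁

-- So few vertices leave no room for an edge on either side, so any tournament on `V H` will do; the
-- one chosen is the order of `Fin n`.
∣V∣<3⇒realizable : ¬ 3 ≤ ∣ V H ∣ → Realizable H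
∣V∣<3⇒realizable {H = H} ∣V∣≱3 = order , refl , λ e → mk⇔
  (λ Ee → ⊥-elim (large (E⇒⊆V H Ee) (E⇒∣∣≡3 H Ee)))
  (λ (e⊆V , ∣e∣≡3 , _) → ⊥-elim (large e⊆V ∣e∣≡3))
  where
  large : ∀ {e} → e ⊆ V H → ∣ e ∣ ≢ 3
  large e⊆V ∣e∣≡3 = ∣V∣≱3 (≤-trans (≤-reflexive (sym ∣e∣≡3)) (p⊆q⇒∣p∣≤∣q∣ e⊆V))
  compare : x ∈ V H → y ∈ V H → x ≢ y →
            ((x ∈ V H × y ∈ V H) × x Fin.< y) ⊎ ((y ∈ V H × x ∈ V H) × y Fin.< x)
  compare {x} {y} x∈ y∈ x≢y with Fin.<-cmp x y
  ... | tri< x<y _ _ = inj₁ ((x∈ , y∈) , x<y)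
  ... | tri≈ _ x≡y _ = ⊥-elim (x≢y x≡y)
  ... | tri> _ _ y<x = inj₂ ((y∈ , x∈) , y<x)
  order : Tournament _
  order = record
    { V     = V H
    ; _⟶_   = λ x y → (x ∈ V H × y ∈ V H) × x Fin.< y
    ; ⟶⇒∈V  = proj₁
    ; asym  = λ (_ , x<y) (_ , y<x) → Fin.<-asym x<y y<x
    ; total = compare
    }

-- Modules

module _ {H : Hypergraph n} {M : Subset n} (isModule : Module H M) where
  open Module isModule

  -- As `c` keeps the edge from lying inside `M`, `replace` makes its trace on `M` a singleton,
  -- which cannot hold both `a` and `b`.
  ¬E-meets-twice : a ∈ M → b ∈ M → c ∉ M → a ≢ b → ¬ E H (tri a b c)
  ¬E-meets-twice {a} {b} {c} a∈M b∈M c∉M a≢b Ee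
    with replace _ Ee (a , x∈p∩q⁺ (a∈tri a b c , a∈M)) (c , x∈p∧x∉q⇒x∈p─q (c∈tri a b c) c∉M)
  ... | m , _ , e∩M≡ , _ = a≢b (trans (≡m (a∈tri a b c) a∈M) (sym (≡m (b∈tri a b c) b∈M)))
    where
    ≡m : x ∈ tri a b c → x ∈ M → x ≡ m
    ≡m x∈e x∈M = x∈⁅y⁆⇒x≡y m (subst (_ ∈_) e∩M≡ (x∈p∩q⁺ (x∈e , x∈M)))

  E-replace : a ∈ M → k ∈ M → b ∉ M → c ∉ M → E H (tri a b c) → E H (tri k b c)
  E-replace {a} {k} {b} {c} a∈M k∈M b∉M c∉M Ee
    with replace _ Ee (a , x∈p∩q⁺ (a∈tri a b c , a∈M)) (c , x∈p∧x∉q⇒x∈p─q (c∈tri a b c) c∉M)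
  ... | m , _ , e∩M≡ , E-swap
    -- The trace `⁅ m ⁆` contains `a`, so the vertex that `replace` exchanges is `a`.
    with refl ← x∈⁅y⁆⇒x≡y m (subst (a ∈_) e∩M≡ (x∈p∩q⁺ (a∈tri a b c , a∈M)))
    = subst (E H) (⊆-antisym ⊆tri
        (tri⊆ (x∈p∪q⁺ (inj₂ (x∈⁅x⁆ k))) (keep b∉M (b∈tri a b c)) (keep c∉M (c∈tri a b c))))
        (E-swap k k∈M)
    where
    keep : x ∉ M → x ∈ tri a b c → x ∈ (tri a b c - a) ∪ ⁅ k ⁆
    keep x∉M x∈ = x∈p∪q⁺ (inj₁ (x∈p∧x≢y⇒x∈p-y x∈ λ { refl → x∉M a∈M }))
    ⊆tri : (tri a b c - a) ∪ ⁅ k ⁆ ⊆ tri k b c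
    ⊆tri x∈ with x∈p∪q⁻ (tri a b c - a) ⁅ k ⁆ x∈
    ... | inj₂ x∈⁅k⁆ = ∈tri⁺ (inj₁ (x∈⁅y⁆⇒x≡y k x∈⁅k⁆))
    ... | inj₁ x∈-a = ∈tri⁺ (inj₂
      ([ (λ x≡a → ⊥-elim (x∈p-y⇒x≢y (tri a b c) x∈-a x≡a)) , id ]′
        (∈tri⁻ (p─q⊆p (tri a b c) ⁅ a ⁆ x∈-a))))

-- Makes the case split of the induction constructive: with decidable edges, being a module is a
-- finite check.
module? : (H : Hypergraph n) (M : Subset n) → Dec (Module H M)
module? H M with M ⊆? V H | allSubset? (λ e →
    E? H e →-dec nonempty? (e ∩ M) →-dec nonempty? (e ─ M) →-dec
    any? λ m → (m ∈? M) ×-dec (e ∩ M ≟ˢ ⁅ m ⁆) ×-dec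
      all? λ k → (k ∈? M) →-dec E? H ((e - m) ∪ ⁅ k ⁆))
... | yes M⊆V | yes replace  = yes record { M⊆V = M⊆V ; replace = replace }
... | no M⊈V  | _            = no λ isModule → M⊈V (Module.M⊆V isModule)
... | yes _   | no ¬replace  = no λ isModule → ¬replace (Module.replace isModule)

trivial? : (H : Hypergraph n) (M : Subset n) → Dec (Trivial H M)
trivial? H M = (M ≟ˢ ⊥) ⊎-dec (M ≟ˢ V H) ⊎-dec
  any? λ v → (v ∈? V H) ×-dec (M ≟ˢ ⁅ v ⁆)

-- Gluing

module Glue {H : Hypergraph n} {M : Subset n} (isModule : Module H M)
            {m : Fin n} (m∈M : m ∈ M)
            {S : Tournament n} (S-H[M] : S Realizes (H [ M ]))
            {R : Tournament n} (R-H[N] : R Realizes (H [ (V H ─ M) ∪ ⁅ m ⁆ ])) where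
  open Module isModule using (M⊆V)
  module S = Tournament S
  module R = Tournament R

  N : Subset n
  N = (V H ─ M) ∪ ⁅ m ⁆

  S-V : M ≡ S.V
  S-V = proj₁ S-H[M]

  R-V : N ≡ R.V
  R-V = proj₁ R-H[N]

  S-E : ∀ a b c → Distinct a b c → E (H [ M ]) (tri a b c) ⇔ Cyc± S a b c
  S-E = proj₂ (Realizes⇒RealizesTriples {T = S} {H = H [ M ]} S-H[M])

  R-E : ∀ a b c → Distinct a b c → E (H [ N ]) (tri a b c) ⇔ Cyc± R a b c
  R-E = proj₂ (Realizes⇒RealizesTriples {T = R} {H = H [ N ]} R-H[N])

  ρ : Fin n → Fin n
  ρ x with x ∈? M
  ... | yes _ = m
  ... | no  _ = x

  ρ-∈ : x ∈ M → ρ x ≡ m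
  ρ-∈ {x} x∈M with x ∈? M
  ... | yes _  = refl
  ... | no x∉M = ⊥-elim (x∉M x∈M)

  ρ-∉ : x ∉ M → ρ x ≡ x
  ρ-∉ {x} x∉M with x ∈? M
  ... | yes x∈M = ⊥-elim (x∉M x∈M)
  ... | no _    = refl

  ρ-∈N : x ∈ V H → ρ x ∈ N
  ρ-∈N {x} x∈V with x ∈? M
  ... | yes _  = x∈p∪q⁺ (inj₂ (x∈⁅x⁆ m))
  ... | no x∉M = x∈p∪q⁺ (inj₁ (x∈p∧x∉q⇒x∈p─q x∈V x∉M))

  ρ-≡ : x ∈ M → y ∈ M → ρ x ≡ ρ y
  ρ-≡ x∈M y∈M = trans (ρ-∈ x∈M) (sym (ρ-∈ y∈M))

  -- A vertex outside `M` is its own image, while all of `M` goes to `m`, which lies in `M`; so only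
  -- pairs inside `M` are identified.
  ρ-≢ : y ∉ M → x ≢ y → ρ x ≢ ρ y
  ρ-≢ {y} {x} y∉M x≢y ρ≡ with x ∈? M
  ... | yes _ = y∉M (subst (_∈ M) (trans ρ≡ (ρ-∉ y∉M)) m∈M)
  ... | no  _ = x≢y (trans ρ≡ (ρ-∉ y∉M))

  -- For x, y in M the second alternative is void, as then ρ x ≡ ρ y.
  infix 4 _⟶_

  _⟶_ : Fin n → Fin n → Set
  x ⟶ y = x S.⟶ y ⊎ (x ∈ V H × y ∈ V H) × ρ x R.⟶ ρ y

  S⇒∈M : x S.⟶ y → x ∈ M × y ∈ M
  S⇒∈M xy = subst₂ (λ p q → _ ∈ p × _ ∈ q) (sym S-V) (sym S-V) (S.⟶⇒∈V xy)

  asym : x ⟶ y → ¬ (y ⟶ x)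
  asym (inj₁ xy)       (inj₁ yx)       = S.asym xy yx
  asym (inj₁ xy)       (inj₂ (_ , yx)) = R.irrefl (let x∈ , y∈ = S⇒∈M xy in ρ-≡ y∈ x∈) yx
  asym (inj₂ (_ , xy)) (inj₁ yx)       = R.irrefl (let y∈ , x∈ = S⇒∈M yx in ρ-≡ x∈ y∈) xy
  asym (inj₂ (_ , xy)) (inj₂ (_ , yx)) = R.asym xy yx

  R-total : x ∈ V H → y ∈ V H → ρ x ≢ ρ y → x ⟶ y ⊎ y ⟶ x
  R-total x∈V y∈V ρ≢ = Sum.map (λ xy → inj₂ ((x∈V , y∈V) , xy)) (λ yx → inj₂ ((y∈V , x∈V) , yx))
    (R.total (ρ-∈R x∈V) (ρ-∈R y∈V) ρ≢)
    where
    ρ-∈R : x ∈ V H → ρ x ∈ R.V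
    ρ-∈R {x} x∈V = subst (ρ x ∈_) R-V (ρ-∈N x∈V)

  total : x ∈ V H → y ∈ V H → x ≢ y → x ⟶ y ⊎ y ⟶ x
  total {x} {y} x∈V y∈V x≢y = by (x ∈? M) (y ∈? M)
    where
    by : Dec (x ∈ M) → Dec (y ∈ M) → x ⟶ y ⊎ y ⟶ x
    by (yes x∈M) (yes y∈M) =
      Sum.map inj₁ inj₁ (S.total (subst (_ ∈_) S-V x∈M) (subst (_ ∈_) S-V y∈M) x≢y)
    by _         (no y∉M)  = R-total x∈V y∈V (ρ-≢ y∉M x≢y)
    by (no x∉M)  _         = R-total x∈V y∈V (≢-sym (ρ-≢ x∉M (≢-sym x≢y)))

  -- The substitution of `S` for the vertex `m` of `R`; `M` becomes an interval of the resulting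
  -- tournament.
  glued : Tournament n
  glued = record
    { V     = V H
    ; _⟶_   = _⟶_
    ; ⟶⇒∈V  = [ (λ xy → let x∈ , y∈ = S⇒∈M xy in M⊆V x∈ , M⊆V y∈) , proj₁ ]′
    ; asym  = asym
    ; total = total
    }

  -- Together with `arc-outside`, lets a cyclic triple be translated arc by arc into `S` or `R`.
  arc-inside : x ∈ M → y ∈ M → x ⟶ y ⇔ x S.⟶ y
  arc-inside x∈M y∈M = mk⇔
    [ id , (λ (_ , xy) → ⊥-elim (R.irrefl (ρ-≡ x∈M y∈M) xy)) ]′ inj₁

  arc⇒R : x ∉ M ⊎ y ∉ M → x ⟶ y → ρ x R.⟶ ρ y
  arc⇒R ∉M (inj₁ xy)       = let x∈ , y∈ = S⇒∈M xy in ⊥-elim ([ (λ x∉ → x∉ x∈) , (λ y∉ → y∉ y∈) ]′ ∉M)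
  arc⇒R ∉M (inj₂ (_ , xy)) = xy

  -- A vertex outside `V H` is outside `M`, hence its own image under `ρ`, and so not in `N`.
  R⇒∈V : ρ x R.⟶ ρ y → x ∈ V H × y ∈ V H
  R⇒∈V xy = let x∈ , y∈ = R.⟶⇒∈V xy in ∈V x∈ , ∈V y∈
    where
    ∈V : ρ x ∈ R.V → x ∈ V H
    ∈V {x} ρx∈ with x ∈? M
    ... | yes x∈M = M⊆V x∈M
    ... | no  x∉M with x∈p∪q⁻ (V H ─ M) ⁅ m ⁆ (subst (_ ∈_) (sym R-V) ρx∈)
    ...   | inj₁ x∈  = p─q⊆p (V H) M x∈
    ...   | inj₂ x∈⁅m⁆ = ⊥-elim (x∉M (subst (_∈ M) (sym (x∈⁅y⁆⇒x≡y m x∈⁅m⁆)) m∈M))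

  arc-outside : x ∉ M ⊎ y ∉ M → x ⟶ y ⇔ ρ x R.⟶ ρ y
  arc-outside ∉M = mk⇔ (arc⇒R ∉M) (λ xy → inj₂ (R⇒∈V xy , xy))

  Triple : Fin n → Fin n → Fin n → Set
  Triple a b c = E H (tri a b c) ⇔ Cyc± glued a b c

  -- Lets each case below assume that the vertices in `M` come first.
  rotate : Triple a b c → Triple b c a
  rotate {a} {b} {c} abc = mk⇔
    (λ Ee → Cyc±-rotate {T = glued} (to abc (subst (E H) (sym (tri-rotate a b c)) Ee)))
    (λ cyc → subst (E H) (tri-rotate a b c)
      -- Rotation has order three, so its inverse is its square.
      (from abc (Cyc±-rotate {T = glued} (Cyc±-rotate {T = glued} cyc))))

  three-inside : Distinct a b c → a ∈ M → b ∈ M → c ∈ M → Triple a b c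
  three-inside {a} {b} {c} abc a∈ b∈ c∈ =
    (cyc ⇔-∘ S-E a b c abc) ⇔-∘ mk⇔ (λ Ee → []-edge H Ee (tri⊆ a∈ b∈ c∈)) proj₁
    where
    cyc : Cyc± S a b c ⇔ Cyc± glued a b c
    cyc = ⇔-sym
      ((arc-inside a∈ b∈ ×-⇔ arc-inside b∈ c∈ ×-⇔ arc-inside c∈ a∈) ⊎-⇔
       (arc-inside a∈ c∈ ×-⇔ arc-inside c∈ b∈ ×-⇔ arc-inside b∈ a∈))

  -- Both sides fail. In `glued`, `a` and `b` have the same image, so `c` dominates both or is
  -- dominated by both, which no 3-cycle allows.
  two-inside : Distinct a b c → a ∈ M → b ∈ M → c ∉ M → Triple a b c
  two-inside {a} {b} {c} (a≢b , _ , _) a∈ b∈ c∉ = mk⇔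
    (λ Ee → ⊥-elim (¬E-meets-twice isModule a∈ b∈ c∉ a≢b Ee))
    [ (λ (_ , bc , ca) → ⊥-elim (R.asym (arc⇒R (inj₂ c∉) bc)
        (subst (ρ c R.⟶_) (ρ-≡ a∈ b∈) (arc⇒R (inj₁ c∉) ca))))
    , (λ (ac , cb , _) → ⊥-elim (R.asym (arc⇒R (inj₂ c∉) ac)
        (subst (ρ c R.⟶_) (ρ-≡ b∈ a∈) (arc⇒R (inj₁ c∉) cb)))) ]′

  -- If `a` lies in `M`, the module property exchanges it for `m` and back; otherwise `ρ` fixes it.
  E-ρ : b ∉ M → c ∉ M → E H (tri a b c) ⇔ E H (tri (ρ a) b c)
  E-ρ {a = a} b∉ c∉ with a ∈? M
  ... | yes a∈ = mk⇔ (E-replace isModule a∈ m∈M b∉ c∉) (E-replace isModule m∈M a∈ b∉ c∉)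
  ... | no  _  = ⇔-id _

  two-outside : Distinct a b c → b ∉ M → c ∉ M → Triple a b c
  two-outside {a} {b} {c} (a≢b , b≢c , c≢a) b∉ c∉ =
    -- From the bottom up: the edge is moved along `ρ`, which is injective on this triple,
    -- restricted to `N`, turned into a cycle of `R`, and lifted to `glued`.
    ⇔-sym ((arc-outside (inj₂ b∉) ×-⇔ arc-outside (inj₁ b∉) ×-⇔ arc-outside (inj₁ c∉)) ⊎-⇔
           (arc-outside (inj₂ c∉) ×-⇔ arc-outside (inj₁ c∉) ×-⇔ arc-outside (inj₁ b∉)))
    ⇔-∘ (R-E (ρ a) (ρ b) (ρ c)
          (ρ-≢ b∉ a≢b , ρ-≢ c∉ b≢c , ≢-sym (ρ-≢ c∉ (≢-sym c≢a)))
    ⇔-∘ (mk⇔ (λ Ee → []-edge H Ee (within Ee)) proj₁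
    ⇔-∘ (subst₂ (λ b′ c′ → E H (tri a b c) ⇔ E H (tri (ρ a) b′ c′))
           (sym (ρ-∉ b∉)) (sym (ρ-∉ c∉)) (E-ρ b∉ c∉))))
    where
    within : E H (tri (ρ a) (ρ b) (ρ c)) → tri (ρ a) (ρ b) (ρ c) ⊆ N
    within Ee = tri⊆
      (fixed a (E⇒⊆V H Ee (a∈tri (ρ a) (ρ b) (ρ c))))
      (fixed b (E⇒⊆V H Ee (b∈tri (ρ a) (ρ b) (ρ c))))
      (fixed c (E⇒⊆V H Ee (c∈tri (ρ a) (ρ b) (ρ c))))
      where
      fixed : ∀ x → ρ x ∈ V H → ρ x ∈ N
      fixed x ρx∈ with x ∈? M
      ... | yes _ = x∈p∪q⁺ (inj₂ (x∈⁅x⁆ m))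
      ... | no x∉ = x∈p∪q⁺ (inj₁ (x∈p∧x∉q⇒x∈p─q ρx∈ x∉))

  triples : ∀ a b c → Distinct a b c → Triple a b c
  triples a b c abc@(a≢b , b≢c , c≢a) = by (a ∈? M) (b ∈? M) (c ∈? M)
    where
    by : Dec (a ∈ M) → Dec (b ∈ M) → Dec (c ∈ M) → Triple a b c
    by (yes a∈) (yes b∈) (yes c∈) = three-inside abc a∈ b∈ c∈
    by (yes a∈) (yes b∈) (no c∉)  = two-inside abc a∈ b∈ c∉
    by (no a∉)  (yes b∈) (yes c∈) = rotate (rotate (two-inside (b≢c , c≢a , a≢b) b∈ c∈ a∉))
    by (yes a∈) (no b∉)  (yes c∈) = rotate (two-inside (c≢a , a≢b , b≢c) c∈ a∈ b∉)
    -- From here on at most one vertex lies in `M`; two others are rotated into the last positions.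
    by _        (no b∉)  (no c∉)  = two-outside abc b∉ c∉
    by (no a∉)  _        (no c∉)  = rotate (rotate (two-outside (b≢c , c≢a , a≢b) c∉ a∉))
    by (no a∉)  (no b∉)  _        = rotate (two-outside (c≢a , a≢b , b≢c) a∉ b∉)

  realizable : Realizable H
  realizable = glued , RealizesTriples⇒Realizes {T = glued} {H = H} (refl , triples)

-- Any `m` in `M` works. Since `M` is not `⁅ m ⁆`, it has a second vertex `k`, which the contraction
-- removes, so the contracted vertex set is proper too.
nontrivial-splits : Module H M → ¬ Trivial H M →
  M ⊂ V H × ∃[ m ] m ∈ M × (V H ─ M) ∪ ⁅ m ⁆ ⊂ V H
nontrivial-splits {H = H} {M = M} isModule nontrivial with nonempty? M
... | no empty = ⊥-elim (nontrivial (inj₁ (Empty-unique empty)))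
... | yes (m , m∈M)
  with _ , k , k∈M , k∉⁅m⁆ ← ⊆∧≢⇒⊂ {p = ⁅ m ⁆} {q = M}
         (λ x∈ → subst (_∈ M) (sym (x∈⁅y⁆⇒x≡y m x∈)) m∈M)
         (λ ⁅m⁆≡M → nontrivial (inj₂ (inj₂ (m , Module.M⊆V isModule m∈M , sym ⁅m⁆≡M))))
  = ⊆∧≢⇒⊂ M⊆V (λ M≡V → nontrivial (inj₂ (inj₁ M≡V)))
  , m , m∈M
  , (λ x∈ → [ p─q⊆p (V H) M , (λ x∈⁅m⁆ → subst (_∈ V H) (sym (x∈⁅y⁆⇒x≡y m x∈⁅m⁆)) (M⊆V m∈M)) ]′
       (x∈p∪q⁻ (V H ─ M) ⁅ m ⁆ x∈))
  , k , M⊆V k∈M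
  , (λ k∈ → [ (λ k∈─ → x∈p─q⇒x∉q (V H) M k∈─ k∈M) , k∉⁅m⁆ ]′ (x∈p∪q⁻ (V H ─ M) ⁅ m ⁆ k∈))
  where open Module isModule using (M⊆V)

-- Induction on the number of vertices

module _ (H : Hypergraph n)
         (primes : ∀ W → W ⊆ V H → Prime (H [ W ]) → Realizable (H [ W ])) where

  -- Strong induction on the size of `W`, over all induced subhypergraphs, since the two pieces of a
  -- splitting need not be prime.
  induced-realizable : ∀ W → Acc _<_ ∣ W ∣ → W ⊆ V H → Realizable (H [ W ])
  induced-realizable W (acc rec) W⊆V
    with anySubset? (λ M → module? (H [ W ]) M ×-dec ¬? (trivial? (H [ W ]) M))
  ... | yes (M , isModule , nontrivial)
    with M⊂W , m , m∈M , N⊂W ← nontrivial-splits isModule nontrivial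
    = let S , S-realizes = smaller M⊂W
          R , R-realizes = smaller N⊂W
      in Glue.realizable {H = H [ W ]} isModule m∈M {S} S-realizes {R} R-realizes
    where
    smaller : ∀ {X} → X ⊂ W → Realizable ((H [ W ]) [ X ])
    smaller {X} X⊂W@(X⊆W , _) = ≈-realizable ((H [ W ]) [ X ]) (H [ X ]) ([]-[] {H = H} X⊆W)
      (induced-realizable X (rec (p⊂q⇒∣p∣<∣q∣ X⊂W)) (W⊆V ∘ X⊆W))
  ... | no none with 3 ≤? ∣ W ∣
  -- The search found no nontrivial module; as `Trivial` is decidable, every module is trivial.
  ...   | yes 3≤∣W∣ = primes W W⊆V (3≤∣W∣ , λ M isModule →
    decidable-stable (trivial? (H [ W ]) M) λ nontrivial → none (M , isModule , nontrivial))
  ...   | no  3≰∣W∣ = ∣V∣<3⇒realizable {H = H [ W ]} 3≰∣W∣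

theorem12 : ∀ {n : ℕ} (H : Hypergraph n) →
    Realizable H ⇔ (∀ (W : Subset n) → W ⊆ Hypergraph.V H → Prime (H [ W ]) → Realizable (H [ W ]))
theorem12 H = mk⇔ hereditary λ primes →
  -- The edge predicate of `H [ V H ]` carries an extra inclusion, so the result is transferred
  -- along `≈`.
  ≈-realizable H (H [ V H ]) ([V]-≈ H)
    (induced-realizable H primes (V H) (<-wellFounded _) ⊆-refl)
  where
  hereditary : Realizable H → ∀ W → W ⊆ V H → Prime (H [ W ]) → Realizable (H [ W ])
  hereditary realizable W W⊆V _ = []-realizable {H = H} W⊆V realizable
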